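{- Let $r > 1$ and $k > 1$ be integers such that $r < W(r,k)$ and $k < W(r,k)$, and let $n \geq 1$ be the exponent of the leading power of $r$ in the base-$r$ expansion of $W(r,k)$. If $k \geq \sqrt{n+1}$, then $$W(r,k) < r^{n+1} \leq r^{k^{2}}.$$
   Context: For positive integers $r, k$, the van der Waerden number $W(r,k)$ is the least positive integer $N$ such that every coloring of the integer interval $[1,N]=\{1,\dots,N\}$ with $r$ colors contains a monochromatic arithmetic progression of $k$ terms. For $W(r,k) > r > 1$, write the base-$r$ expansion $W(r,k) = b_{n}r^{n} + b_{n-1}r^{n-1} + \cdots + b_{0}$ with integers $1 \leq b_n \leq r-1$ and $0 \leq b_i \leq r-1$ for $i<n$; the exponent of the leading power is this $n$, equivalently the unique integer with $r^{n} \leq W(r,k) < r^{n+1}$. -}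

module Defs where

open import Data.Digit using (Digit)
open import Data.Fin.Base using (Fin; toℕ; fromℕ)
open import Data.Integer.Base using (+_)
open import Data.Nat.Base using (ℕ; suc; _+_; _*_; _^_; _≤_; _<_)
open import Data.Product.Base using (∃-syntax; _×_)
open import Data.Rational.Base as ℚ using (ℚ; 0ℚ)
open import Data.Sum.Base using (_⊎_)
open import Data.Vec.Base using (sum; tabulate)
open import Data.Vec.Functional using (Vector)
open import Level using (0ℓ)
open import Relation.Binary.PropositionalEquality using (_≡_)
open import Relation.Unary using (Pred; _⊆_)

-- The index i : Fin N stands for the integer suc (toℕ i) of [1,N].
Colouring : ℕ → ℕ → Set
Colouring r N = Fin N → Fin r

-- The terms are a, a + d, …, a + (k - 1) d; each must lie in [1,N].
-- The common difference d is positive.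
HasMonochromaticAP : ∀ {r N} → ℕ → Colouring r N → Set
HasMonochromaticAP {r} {N} k χ =
  ∃[ a ] ∃[ d ] 0 < d × ∃[ c ] ((j : Fin k) →
    ∃[ i ] suc (toℕ i) ≡ a + toℕ j * d × χ i ≡ c)

Unavoidable : ℕ → ℕ → ℕ → Set
Unavoidable r k N = (χ : Colouring r N) → HasMonochromaticAP k χ

-- W = W(r,k), as a relation, so that van der Waerden's theorem (the existence
-- of such a W) is not needed to state results about W(r,k).
record IsVanDerWaerdenNumber (r k W : ℕ) : Set where
  field
    positive    : 0 < W
    unavoidable : Unavoidable r k W
    least       : ∀ N → 0 < N → Unavoidable r k N → W ≤ N

-- b i is the coefficient of r ^ i.
record BaseExpansion (r m n : ℕ) : Set where
  field
    b         : Vector (Digit r) (suc n)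
    leading   : 1 ≤ toℕ (b (fromℕ n))
    expansion : m ≡ sum (tabulate λ i → toℕ (b i) * r ^ toℕ i)

-- Real numbers are represented by their lower Dedekind cuts: x is the set of
-- rationals q < x, and the order of the reals is inclusion of cuts.
Cut : Set₁
Cut = Pred ℚ 0ℓ

infix 4 _≥ᶜ_
_≥ᶜ_ : Cut → Cut → Set
x ≥ᶜ y = y ⊆ x

fromℕᶜ : ℕ → Cut
fromℕᶜ m q = q ℚ.< + m ℚ./ 1

infix 9 √_
√_ : ℕ → Cut
(√ m) q = q ℚ.< 0ℚ ⊎ q ℚ.* q ℚ.< + m ℚ./ 1

{-# OPTIONS --safe #-}
module Submission where

open import Defs
open import Data.Nat.Base
  using (ℕ; zero; suc; _+_; _*_; _^_; _≤_; _<_; >-nonZero)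
open import Data.Product.Base using (_×_; _,_)
open import Data.Digit using (Digit)
open import Data.Fin.Base using (toℕ; zero; suc)
open import Data.Fin.Properties using (toℕ<n)
open import Data.Integer.Base as ℤ using (+_)
import Data.Integer.Properties as ℤ
open import Data.Nat.Properties
open import Data.Rational.Base as ℚ using (toℚᵘ)
import Data.Rational.Properties as ℚ
open import Data.Rational.Unnormalised.Base as ℚᵘ using (mkℚᵘ)
import Data.Rational.Unnormalised.Properties as ℚᵘ
open import Data.Sum.Base using (inj₂)
open import Data.Vec.Base using (sum; tabulate)
open import Data.Vec.Functional using (Vector; tail)
open import Relation.Binary.PropositionalEquality using (refl; sym; cong; subst)

-- Both inequalities are elementary. Digits are at most r - 1, so adding 1 to an expansion with n +
-- 1 digits carries at most up to r^(n+1) (`weightedDigitSum-bound`). The hypothesis on k squares to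
-- n + 1 ≤ k² (`≥ᶜ√⇒≤-square`), and r^x is monotone in x.

-- A carry: since b 0 + 1 ≤ r, the extra `w 0` turns the lowest digit into at most `r * w 0`, hence
-- at most `w 1`, which is the extra term for the remaining digits. General weights let the
-- induction shift `w` instead of factoring r out of the sum.
weightedDigitSum-bound : ∀ {r} (w : ℕ → ℕ) → (∀ i → r * w i ≤ w (suc i)) →
  ∀ m (b : Vector (Digit r) m) →
  w 0 + sum (tabulate λ i → toℕ (b i) * w (toℕ i)) ≤ w m
weightedDigitSum-bound w grows zero b = ≤-reflexive (+-identityʳ (w 0))
weightedDigitSum-bound {r} w grows (suc m) b = begin
  w 0 + (toℕ (b zero) * w 0 + s)  ≡⟨ +-assoc (w 0) _ s ⟨
  suc (toℕ (b zero)) * w 0 + s    ≤⟨ +-monoˡ-≤ s (*-monoˡ-≤ (w 0) (toℕ<n (b zero))) ⟩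
  r * w 0 + s                     ≤⟨ +-monoˡ-≤ s (grows 0) ⟩
  w 1 + s                         ≤⟨ weightedDigitSum-bound (λ i → w (suc i)) (λ i → grows (suc i)) m (tail b) ⟩
  w (suc m)                       ∎
  where
  open ≤-Reasoning
  s = sum (tabulate λ i → toℕ (tail b i) * w (suc (toℕ i)))

baseExpansion-upper : ∀ {r m n} → BaseExpansion r m n → m < r ^ suc n
baseExpansion-upper {r} {n = n} e = subst (_< r ^ suc n) (sym expansion)
  -- Here `w 0` is r^0, which computes to 1, so the bound is already the strict inequality.
  (weightedDigitSum-bound (r ^_) (λ _ → ≤-refl) (suc n) b)
  where open BaseExpansion e

toℚᵘ-/1 : ∀ m → toℚᵘ (+ m ℚ./ 1) ℚᵘ.≃ mkℚᵘ (+ m) 0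
toℚᵘ-/1 m = ℚ.toℚᵘ-fromℚᵘ (mkℚᵘ (+ m) 0)

-- `ℚ./` normalises by a gcd that is stuck on a variable numerator; over unnormalised rationals all
-- denominators compute to 1, leaving an integer comparison.
square-/1-< : ∀ k m → k * k < m → + k ℚ./ 1 ℚ.* (+ k ℚ./ 1) ℚ.< + m ℚ./ 1
square-/1-< k m k²<m = ℚ.toℚᵘ-cancel-< (begin-strict
  toℚᵘ (+ k ℚ./ 1 ℚ.* (+ k ℚ./ 1))           ≃⟨ ℚ.toℚᵘ-homo-* (+ k ℚ./ 1) (+ k ℚ./ 1) ⟩
  toℚᵘ (+ k ℚ./ 1) ℚᵘ.* toℚᵘ (+ k ℚ./ 1)     ≃⟨ ℚᵘ.*-cong (toℚᵘ-/1 k) (toℚᵘ-/1 k) ⟩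
  mkℚᵘ (+ k ℤ.* + k) 0                       ≡⟨ cong (λ i → mkℚᵘ i 0) (ℤ.pos-* k k) ⟨
  mkℚᵘ (+ (k * k)) 0                         <⟨ ℚᵘ.*<* (ℤ.*-monoʳ-<-pos (+ 1) (ℤ.+<+ k²<m)) ⟩
  mkℚᵘ (+ m) 0                               ≃⟨ toℚᵘ-/1 m ⟨
  toℚᵘ (+ m ℚ./ 1)                           ∎)
  where open ℚᵘ.≤-Reasoning

-- If k² < m, the rational k lies in the cut √ m but not in the cut of k.
≥ᶜ√⇒≤-square : ∀ k m → fromℕᶜ k ≥ᶜ √ m → m ≤ k * k
≥ᶜ√⇒≤-square k m k≥√m = ≮⇒≥ λ k²<m → ℚ.<-irrefl refl (k≥√m {+ k ℚ./ 1} (inj₂ (square-/1-< k m k²<m)))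

theorem2p2 : (r k W n : ℕ) → 1 < r → 1 < k →
    IsVanDerWaerdenNumber r k W → r < W → k < W →
    1 ≤ n → BaseExpansion r W n →
    fromℕᶜ k ≥ᶜ √ (suc n) →
    W < r ^ suc n × r ^ suc n ≤ r ^ (k ^ 2)
theorem2p2 r k W n 1<r _ _ _ _ _ expansion k≥√1+n =
  baseExpansion-upper expansion ,
  ^-monoʳ-≤ r {{>-nonZero (<⇒≤ 1<r)}}
    -- `k ^ 2` unfolds to `k * (k * 1)`.
    (subst (suc n ≤_) (cong (k *_) (sym (*-identityʳ k))) (≥ᶜ√⇒≤-square k (suc n) k≥√1+n))
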